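{- Given a set $X\subseteq A^*$ and an integer $k\ge 1$, the three following conditions are equivalent: (i) For all $x,y\in X$, $\mathcal{P}_k(x)\cap\mathcal{P}_k(y)\ne\emptyset$ implies $x=y$. (ii) For every $x\in X$ we have $\mathcal{P}_{2k}(x)\cap X=\{x\}$. (iii) $\underline{\mathcal{P}_{2k}}(X)\cap X=\emptyset$.
   Context: $A$ is a finite alphabet with $|A|\ge 2$; $A^*$ is the free monoid over $A$ and $|w|$ is the length of $w$. For $w,w'\in A^*$, $w\wedge w'$ is their longest common prefix; for an integer $m\ge 1$, $(w,w')\in\mathcal{P}_m$ iff $|w|+|w'|-2|w\wedge w'|\le m$, and $\underline{\mathcal{P}_m}=\mathcal{P}_m\setminus\{(w,w):w\in A^*\}$. For a relation $\tau\subseteq A^*\times A^*$, $\tau(X)=\{y:\exists x\in X,\ (x,y)\in\tau\}$ and $\tau(x)=\tau(\{x\})$. -}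

module Defs where

open import Level using (Level; 0ℓ; _⊔_) renaming (suc to lsuc)
open import Data.Nat using (ℕ; _+_; _*_; _∸_; _≤_; z≤n; s≤s)
open import Data.Nat.Properties using (≤-trans; ≤-reflexive; +-mono-≤; +-identityʳ)
open import Data.Fin using (Fin)
open import Data.Fin.Properties using (inj⇒≟)
open import Data.List using (List; []; _∷_; length)
open import Data.List.Relation.Binary.Prefix.Heterogeneous using (Prefix; []; _∷_)
open import Data.Product using (_×_; ∃-syntax)
open import Function using (_↔_)
open import Function.Properties.Inverse using (↔⇒↣)
open import Relation.Binary using (Rel; DecidableEquality)
open import Relation.Binary.PropositionalEquality using (_≡_; _≢_; refl; cong; sym; trans)
open import Relation.Nullary using (yes; no; contradiction)
open import Relation.Unary using (Pred; _∈_; ｛_｝)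

record Alphabet (a : Level) : Set (lsuc a) where
  field
    Letter      : Set a
    size        : ℕ
    enumeration : Letter ↔ Fin size
    2≤size      : 2 ≤ size

  infix 4 _≟_
  _≟_ : DecidableEquality Letter
  _≟_ = inj⇒≟ (↔⇒↣ enumeration)

_⟨_⟩ : ∀ {a ℓ₁ ℓ₂} {W : Set a} → Rel W ℓ₁ → Pred W ℓ₂ → Pred W (a ⊔ ℓ₁ ⊔ ℓ₂)
(τ ⟨ X ⟩) y = ∃[ x ] (x ∈ X × τ x y)

module Words {a} (𝔸 : Alphabet a) where
  open Alphabet 𝔸

  Word : Set a
  Word = List Letter

  infixr 7 _∧_
  _∧_ : Word → Word → Word
  []      ∧ _       = []
  (_ ∷ _) ∧ []      = []
  (c ∷ u) ∧ (d ∷ v) with c ≟ d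
  ... | yes _ = c ∷ (u ∧ v)
  ... | no  _ = []

  -- The next three lemmas show that u ∧ v is the longest common prefix.
  ∧-prefixˡ : ∀ u v → Prefix _≡_ (u ∧ v) u
  ∧-prefixˡ []      _       = []
  ∧-prefixˡ (_ ∷ _) []      = []
  ∧-prefixˡ (c ∷ u) (d ∷ v) with c ≟ d
  ... | yes _ = refl ∷ ∧-prefixˡ u v
  ... | no  _ = []

  ∧-prefixʳ : ∀ u v → Prefix _≡_ (u ∧ v) v
  ∧-prefixʳ []      _       = []
  ∧-prefixʳ (_ ∷ _) []      = []
  ∧-prefixʳ (c ∷ u) (d ∷ v) with c ≟ d
  ... | yes c≡d = c≡d ∷ ∧-prefixʳ u v
  ... | no  _   = []

  ∧-longest : ∀ {p} u v → Prefix _≡_ p u → Prefix _≡_ p v → length p ≤ length (u ∧ v)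
  ∧-longest _       _       []       _        = z≤n
  ∧-longest (c ∷ u) (d ∷ v) (e ∷ pu) (f ∷ pv) with c ≟ d
  ... | yes _   = s≤s (∧-longest u v pu pv)
  ... | no  c≢d = contradiction (trans (sym e) f) c≢d

  -- Truncated subtraction is exact here, by 2*∣∧∣≤∣∣+∣∣.
  𝒫 : ℕ → Rel Word 0ℓ
  𝒫 m w w′ = length w + length w′ ∸ 2 * length (w ∧ w′) ≤ m

  𝒫≠ : ℕ → Rel Word a
  𝒫≠ m w w′ = 𝒫 m w w′ × w ≢ w′

  𝒫[_] : ℕ → Word → Pred Word a
  𝒫[ m ] x = 𝒫 m ⟨ ｛ x ｝ ⟩

  private
    prefix-length : ∀ {p u : Word} → Prefix _≡_ p u → length p ≤ length u
    prefix-length []      = z≤n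
    prefix-length (_ ∷ p) = s≤s (prefix-length p)

  2*∣∧∣≤∣∣+∣∣ : ∀ u v → 2 * length (u ∧ v) ≤ length u + length v
  2*∣∧∣≤∣∣+∣∣ u v =
    ≤-trans (≤-reflexive (cong (length (u ∧ v) +_) (+-identityʳ _)))
            (+-mono-≤ (prefix-length (∧-prefixˡ u v)) (prefix-length (∧-prefixʳ u v)))

{-# OPTIONS --safe #-}
-- |w| + |w′| − 2|w ∧ w′| is the distance of w and w′ in the prefix tree. Being a tree distance, it
-- is a metric for which every path can be cut at any intermediate length, so that 𝒫 m followed by
-- 𝒫 n is exactly 𝒫 (m + n). With m = n = k, the balls of radius k around x and y meet if and only
-- if y lies in the ball of radius 2k around x, and the three conditions become reformulations of
-- one another.
module Submission where

open import Defs
open import Data.Nat using (ℕ; _*_; _≤_)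
open import Data.Product using (_×_)
open import Function using (_⇔_)
open import Relation.Binary.PropositionalEquality using (_≡_)
open import Relation.Unary using (Pred; _∈_; _∩_; _≐_; ∅; ｛_｝; Satisfiable)

open import Data.List using ([]; _∷_; length)
open import Data.List.Properties using (≡-dec)
open import Data.Nat using (suc; _+_; z≤n; s≤s; s≤s⁻¹)
open import Data.Nat.Properties hiding (_≟_)
open import Data.Product using (_,_; proj₁; Σ-syntax)
open import Data.Sum using (inj₁; inj₂)
open import Function using (mk⇔)
open import Relation.Binary.PropositionalEquality using (refl; sym; subst; subst₂)
open import Relation.Nullary using (yes; no; contradiction)
open import Relation.Nullary.Decidable using (decidable-stable)

module _ {a} (𝔸 : Alphabet a) where
  open Alphabet 𝔸 using (_≟_)
  open Words 𝔸

  -- 𝒫 without the subtraction: strip some common prefix, then bound the remaining lengths.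
  data Near (m : ℕ) : Word → Word → Set a where
    short : ∀ {u v} → length u + length v ≤ m → Near m u v
    _∷_   : ∀ {u v} c → Near m u v → Near m (c ∷ u) (c ∷ v)

  𝒫⇒Near : ∀ {m} u v → 𝒫 m u v → Near m u v
  𝒫⇒Near []      v       h = short h
  𝒫⇒Near (c ∷ u) []      h = short h
  𝒫⇒Near (c ∷ u) (d ∷ v) h with c ≟ d
  ... | no  _    = short h
  -- A shared first letter adds two to both sides of the truncated subtraction; once the rewrites
  -- expose the successors, they cancel by computation.
  ... | yes refl
    rewrite +-suc (length u) (length v)
          | +-suc (length (u ∧ v)) (length (u ∧ v) + 0) = c ∷ 𝒫⇒Near u v h

  -- The prefix stripped need not be the longest: subtracting for further shared letters only lowers
  -- the left side.
  Near⇒𝒫 : ∀ {m u v} → Near m u v → 𝒫 m u v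
  Near⇒𝒫 {u = u} {v} (short h) = ≤-trans (m∸n≤m _ (2 * length (u ∧ v))) h
  Near⇒𝒫 {u = _ ∷ u} {_ ∷ v} (c ∷ p) with c ≟ c
  ... | no  c≢c = contradiction refl c≢c
  ... | yes _
    rewrite +-suc (length u) (length v)
          | +-suc (length (u ∧ v)) (length (u ∧ v) + 0) = Near⇒𝒫 p

  Near-refl : ∀ {m} u → Near m u u
  Near-refl []      = short z≤n
  Near-refl (c ∷ u) = c ∷ Near-refl u

  Near-sym : ∀ {m u v} → Near m u v → Near m v u
  Near-sym {u = u} {v} (short h) = short (≤-trans (≤-reflexive (+-comm (length v) (length u))) h)
  Near-sym (c ∷ p)               = c ∷ Near-sym p

  Near⇒length≤ : ∀ {m u v} → Near m u v → length v ≤ length u + m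
  Near⇒length≤ {u = u} (short h) = ≤-trans (m+n≤o⇒n≤o (length u) h) (m≤n+m _ _)
  Near⇒length≤ (c ∷ p)           = s≤s (Near⇒length≤ p)

  -- The path from `u` to `w` through the root is already short enough, since `w` is at most `n`
  -- longer than `v`.
  short-Near : ∀ {m n} (u : Word) {v w} → length u + length v ≤ m → Near n v w → Near (m + n) u w
  short-Near {m} {n} u {v} {w} h p = short (begin
    length u + length w         ≤⟨ +-monoʳ-≤ (length u) (Near⇒length≤ p) ⟩
    length u + (length v + n)   ≡⟨ +-assoc (length u) (length v) n ⟨
    length u + length v + n     ≤⟨ +-monoˡ-≤ n h ⟩
    m + n                       ∎)
    where open ≤-Reasoning

  Near-trans : ∀ {m n u v w} → Near m u v → Near n v w → Near (m + n) u w
  Near-trans {u = u} (short h) q = short-Near u h q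
  -- Mirror image of the first case: both paths are reversed, which yields `n + m`.
  Near-trans {m} {n} {w = w} p@(_∷_ {u} c _) (short {v} h) =
    subst (λ j → Near j (c ∷ u) w) (+-comm n m)
      (Near-sym (short-Near w h′ (Near-sym p)))
    where
    h′ : length w + length v ≤ n
    h′ = ≤-trans (≤-reflexive (+-comm (length w) (length v))) h
  Near-trans (c ∷ p) (.c ∷ q) = c ∷ Near-trans p q

  -- Walking from u towards the root, stop after m letters or at the root.
  split-short : ∀ m {n} (u v : Word) → length v ≤ n → length u + length v ≤ m + n →
                Σ[ w ∈ Word ] (Near m u w × length w + length v ≤ n)
  split-short m []          v h₁ _ = [] , Near-refl [] , h₁
  split-short m {n} (c ∷ u) v h₁ h₂ with ≤-<-connex (length (c ∷ u)) m
  ... | inj₁ u≤m = [] , short (≤-trans (≤-reflexive (+-identityʳ _)) u≤m) , h₁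
  ... | inj₂ m<u
    -- The root is more than `m` away, so `c` stays in `w` at the cost of one unit of `n`; `n` is
    -- positive because `length v < n`.
    with s≤s v≤n ← +-cancelˡ-< (length u) (length v) n (≤-trans h₂ (+-monoˡ-≤ n (s≤s⁻¹ m<u)))
    with w , p , h ← split-short m u v v≤n (s≤s⁻¹ (≤-trans h₂ (≤-reflexive (+-suc m _))))
    = c ∷ w , c ∷ p , s≤s h

  Near-split : ∀ m {n u v} → Near (m + n) u v → Σ[ w ∈ Word ] (Near m u w × Near n w v)
  Near-split m (c ∷ p) with w , q , r ← Near-split m p = c ∷ w , c ∷ q , c ∷ r
  Near-split m {n} (short {u} {v} h) with ≤-<-connex (length v) n
  ... | inj₁ v≤n with w , p , q ← split-short m u v v≤n h = w , p , short q
  -- The cut point now lies on the branch towards `v`, so the walk starts from `v` with `m` and `n`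
  -- exchanged.
  ... | inj₂ n<v
    with u≤m ← +-cancelʳ-≤ n (length u) m (≤-trans (+-monoʳ-≤ (length u) (<⇒≤ n<v)) h)
    with w , p , q ← split-short n v u u≤m
                       (subst₂ _≤_ (+-comm (length u) (length v)) (+-comm m n) h)
    = w , Near-sym (short q) , Near-sym p

  𝒫-refl : ∀ {m} u → 𝒫 m u u
  𝒫-refl u = Near⇒𝒫 (Near-refl u)

  𝒫-balls-meet⇒𝒫 : ∀ k {u v} → Satisfiable (𝒫[ k ] u ∩ 𝒫[ k ] v) → 𝒫 (2 * k) u v
  𝒫-balls-meet⇒𝒫 k {u} {v} (w , (_ , refl , p) , (_ , refl , q)) =
    subst (λ j → 𝒫 (k + j) u v) (sym (+-identityʳ k))
      (Near⇒𝒫 (Near-trans (𝒫⇒Near u w p) (Near-sym (𝒫⇒Near v w q))))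

  𝒫⇒𝒫-balls-meet : ∀ k {u v} → 𝒫 (2 * k) u v → Satisfiable (𝒫[ k ] u ∩ 𝒫[ k ] v)
  𝒫⇒𝒫-balls-meet k {u} {v} h
    with w , p , q ← Near-split k (𝒫⇒Near u v (subst (λ j → 𝒫 (k + j) u v) (+-identityʳ k) h))
    = w , (u , refl , Near⇒𝒫 p) , (v , refl , Near⇒𝒫 (Near-sym q))

lemma3p7 : ∀ {a ℓ} (𝔸 : Alphabet a) → let open Words 𝔸 in
    (X : Pred Word ℓ) (k : ℕ) → 1 ≤ k →
    let
    i   = ∀ x y → x ∈ X → y ∈ X → Satisfiable (𝒫[ k ] x ∩ 𝒫[ k ] y) → x ≡ y
    ii  = ∀ x → x ∈ X → (𝒫[ 2 * k ] x ∩ X) ≐ ｛ x ｝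
    iii = (𝒫≠ (2 * k) ⟨ X ⟩ ∩ X) ≐ ∅
    in (i ⇔ ii) × (ii ⇔ iii)
lemma3p7 𝔸 X k _ =
    mk⇔
      (λ i → ball-trivial λ x∈X y∈X p → i _ _ x∈X y∈X (𝒫⇒𝒫-balls-meet 𝔸 k p))
      (λ ii x y x∈X y∈X meet → proj₁ (ii x x∈X) ((x , refl , 𝒫-balls-meet⇒𝒫 𝔸 k meet) , y∈X))
  , mk⇔
      (λ ii → (λ { ((x , x∈X , p , x≢y) , y∈X) →
                   contradiction (proj₁ (ii x x∈X) ((x , refl , p) , y∈X)) x≢y })
            , λ ())
      (λ iii → ball-trivial λ x∈X y∈X p →
         -- Emptiness only refutes `x≢y`; decidable equality of words turns this into an equality.
         decidable-stable (≡-dec _≟_ _ _) λ x≢y → proj₁ iii ((_ , x∈X , p , x≢y) , y∈X))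
  where
  open Alphabet 𝔸 using (_≟_)
  open Words 𝔸

  -- Common route to (ii) from (i) and from (iii).
  ball-trivial : (∀ {x y} → x ∈ X → y ∈ X → 𝒫 (2 * k) x y → x ≡ y) →
                 ∀ x → x ∈ X → (𝒫[ 2 * k ] x ∩ X) ≐ ｛ x ｝
  ball-trivial separated x x∈X =
      (λ { ((_ , refl , p) , y∈X) → separated x∈X y∈X p })
    , λ { refl → (x , refl , 𝒫-refl 𝔸 x) , x∈X }
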